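{- Let $\gamma=d_I+2$ and $\gamma_0=\lfloor (d_I+1)/2\rfloor$. For every $\sigma\ge \gamma/\gamma_0+1$, $\sigma$-FIFO is a $\sigma$-speed optimal algorithm for both C-WGP and F-WGP; that is, on every instance, $\max_j C_{j,\sigma}$ is at most the optimal (unit-speed) value of $\max_j C_j$, and $\max_j F_{j,\sigma}$ is at most the optimal (unit-speed) value of $\max_j F_j$.
   Context: The Wireless Gathering Problem (WGP). An instance consists of a finite connected undirected graph $G=(V,E)$, a sink node $s\in V$, a positive integer $d_I$ (interference radius), and a set of packets $J=\{1,\dots,m\}$; each packet $j$ has an origin $o_j\in V$ and a release date $r_j\in\mathbb{Z}_{\ge 0}$. Time is divided into rounds $0,1,2,\dots$. In a round, if $u,v$ are adjacent, $u$ may send a packet it currently holds to $v$; this is a call $(u,v)$. Let $d(u,v)$ be the shortest-path distance in $G$. Two calls $(u,v)$ and $(u',v')$ in the same round interfere if $d(u',v)\le d_I$ or $d(u,v')\le d_I$; otherwise they are compatible. A feasible schedule specifies, for each round, a set of pairwise compatible calls, each moving one packet, such that every packet exists in a unique copy, packet $j$ is not sent before its release date, and every packet eventually reaches $s$. The completion time $C_j$ is the time at which packet $j$ arrives at $s$ (a packet sent in round $t$ is at its new node at time $t+1$) and the flow time is $F_j=C_j-r_j$. C-WGP minimizes $\max_j C_j$, F-WGP minimizes $\max_j F_j$. Priority Greedy: each packet is given a unique priority; in every round, the available packets (released and not yet at $s$) are considered in order of decreasing priority, and each is sent from its current node to a neighbor one step closer to $s$, provided this call causes no interference with the calls already chosen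 in this round for higher-priority packets. FIFO is the Priority Greedy algorithm in which packets with earlier release dates have higher priority (ties broken arbitrarily). $\sigma$-FIFO: (1) form instance $\mathcal{I}'$ from the given instance by setting release dates $r'_j=\sigma r_j$ (a packet may be sent in round $t$ of $\mathcal{I}'$ only if $t\ge \sigma r_j$); (2) run FIFO on $\mathcal{I}'$, obtaining completion times $C'_j$; (3) speed this schedule up by a factor $\sigma$, so round $t$ is executed at time $t/\sigma$ and packet $j$ has completion time $C_{j,\sigma}=C'_j/\sigma$ and flow time $F_{j,\sigma}=C_{j,\sigma}-r_j$. A $\sigma$-speed algorithm is $\sigma$-speed optimal if on every instance its cost is at most the optimal cost among ordinary (unit-speed) feasible schedules.
   Formalization: The speed factor σ ranges over the rational numbers σ ≥ γ/γ₀+1 rather than over all real numbers. -}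

module Defs where

open import Data.Nat as ℕ using (ℕ; zero; suc; _≤_; _<_; _>_; s≤s; z≤n)
open import Data.Nat.DivMod using (_/_; m≥n⇒m/n>0)
open import Data.Nat.Properties using (m≤n+m)
open import Data.Fin using (Fin)
open import Data.Bool using (Bool; true; false)
open import Data.Product using (Σ; ∃; _×_; _,_)
open import Data.Sum using (_⊎_)
open import Data.Integer using (ℤ; +_)
open import Data.Rational as ℚ using (ℚ)
open import Relation.Nullary using (¬_)
open import Relation.Binary.PropositionalEquality using (_≡_; _≢_)

record Graph : Set where
  field
    n     : ℕ
    adj   : Fin n → Fin n → Bool
    sym   : ∀ u v → adj u v ≡ adj v u
    irrefl : ∀ u → adj u u ≡ false

module _ (G : Graph) where
  open Graph G

  Adj : Fin n → Fin n → Set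
  Adj u v = adj u v ≡ true

  data Walk : Fin n → Fin n → ℕ → Set where
    here : ∀ {u} → Walk u u 0
    step : ∀ {u w v l} → Adj u w → Walk w v l → Walk u v (suc l)

  Connected : Set
  Connected = ∀ u v → ∃ λ l → Walk u v l

  IsDist : Fin n → Fin n → ℕ → Set
  IsDist u v d = Walk u v d × (∀ l → Walk u v l → d ≤ l)

  DistLe : Fin n → Fin n → ℕ → Set
  DistLe u v k = ∃ λ d → IsDist u v d × d ≤ k

  -- A call is a pair (sender, receiver).
  Call : Set
  Call = Fin n × Fin n

  Interfere : ℕ → Call → Call → Set
  Interfere dI (u , v) (u' , v') = DistLe u' v dI ⊎ DistLe u v' dI

  Compatible : ℕ → Call → Call → Set
  Compatible dI c c' = ¬ Interfere dI c c'

  Closer : Fin n → Fin n → Fin n → Set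
  Closer s u v = Adj u v × ∃ λ du → ∃ λ dv → IsDist u s du × IsDist v s dv × dv < du

record Instance : Set where
  field
    graph   : Graph
    sink    : Fin (Graph.n graph)
    dI      : ℕ
    m       : ℕ
    origin  : Fin m → Fin (Graph.n graph)
    release : Fin m → ℕ

module _ (I : Instance) where
  open Instance I
  open Graph graph using (n)

  -- A schedule is given by the position of every packet at every time
  -- (time t = beginning of round t).  Uniqueness of copies is built in.
  Positions : Set
  Positions = ℕ → Fin m → Fin n

  Moves : Positions → ℕ → Fin m → Set
  Moves pos t j = pos (suc t) j ≢ pos t j

  callOf : Positions → ℕ → Fin m → Call graph
  callOf pos t j = pos t j , pos (suc t) j

  Feasible : Positions → Set
  Feasible pos =
      (∀ j → pos 0 j ≡ origin j)
    × (∀ t j → pos (suc t) j ≡ pos t j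
               ⊎ (Adj graph (pos t j) (pos (suc t) j) × release j ≤ t × pos t j ≢ sink))
    × (∀ t j k → j ≢ k → Moves pos t j → Moves pos t k
               → Compatible graph dI (callOf pos t j) (callOf pos t k))
    × (∀ j → ∃ λ t → pos t j ≡ sink)

  Completion : Positions → Fin m → ℕ → Set
  Completion pos j c = pos c j ≡ sink × (∀ t → t < c → pos t j ≢ sink)

  -- FIFO priorities: a ranking (larger = higher priority), injective, with
  -- earlier release dates getting higher priority (ties arbitrary).
  FIFOPriority : (Fin m → ℕ) → Set
  FIFOPriority prio =
      (∀ j k → prio j ≡ prio k → j ≡ k)
    × (∀ j k → release j < release k → prio j > prio k)

  -- Run of the Priority Greedy algorithm with priority prio on the
  -- instance I' whose release dates are σ·r_j (packet j may be sent in
  -- round t only if t ≥ σ·r_j).  In each round every available packet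
  -- (released, not at the sink) attempts a call to some neighbour one step
  -- closer to the sink; it is sent iff this call is compatible with the
  -- calls of all higher-priority packets sent in that round.
  ReleasedScaled : ℚ → ℕ → Fin m → Set
  ReleasedScaled σ t j = σ ℚ.* (+ release j ℚ./ 1) ℚ.≤ (+ t ℚ./ 1)

  GreedyRun : ℚ → (Fin m → ℕ) → Positions → Set
  GreedyRun σ prio pos =
      (∀ j → pos 0 j ≡ origin j)
    × (∀ t j → ¬ (ReleasedScaled σ t j × pos t j ≢ sink) → pos (suc t) j ≡ pos t j)
    × (∀ t j → ReleasedScaled σ t j → pos t j ≢ sink →
         ∃ λ v → Closer graph sink (pos t j) v ×
           (  (pos (suc t) j ≡ v
               × (∀ k → prio k > prio j → Moves pos t k
                    → Compatible graph dI (callOf pos t k) (pos t j , v)))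
            ⊎ (pos (suc t) j ≡ pos t j
               × ∃ λ k → prio k > prio j × Moves pos t k
                    × Interfere graph dI (callOf pos t k) (pos t j , v))))

-- Constants γ = dI + 2, γ₀ = ⌊(dI+1)/2⌋, and the speed threshold γ/γ₀ + 1.
-- (Only meaningful for dI ≥ 1; the value at dI = 0 is an unused dummy.)

γ : ℕ → ℕ
γ dI = dI ℕ.+ 2

γ₀ : ℕ → ℕ
γ₀ dI = (dI ℕ.+ 1) / 2

speedThreshold : ℕ → ℚ
speedThreshold zero = ℚ.0ℚ
speedThreshold (suc k) = ((+ γ (suc k)) ℚ./ γ₀ (suc k)) {{ℕ.>-nonZero (m≥n⇒m/n>0 {suc k ℕ.+ 1} {2} (s≤s (m≤n+m 1 k)))}} ℚ.+ ℚ.1ℚ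

toℚ : ℕ → ℚ
toℚ k = + k ℚ./ 1

{-# OPTIONS --safe #-}

-- If higher-priority k is the last packet to block j in the greedy run, the
-- interference leaves j at most dI + 1 hops behind k, so C′_j ≤ C′_k + min(δ_j, γ),
-- where δ is the distance from the origin to the sink.  Iterating gives a chain of
-- packets of rising priority, ending in an l that is never blocked, with
-- C′_j ≤ ⌈σ r_l⌉ + δ_l + Σ min(δ_x, γ) over the other members x of the chain.
-- In any feasible schedule at most one packet per round gets closer to the sink
-- inside radius γ₀.  Chain members are released no earlier than l, hence r_l + Σ min(δ_x, γ₀),
-- summed over the whole chain, is at most the latest completion T in the chain.
-- As min(δ, γ) ≤ (γ/γ₀) min(δ, γ₀), this yields C′_j ≤ σ T.  Under FIFO the packet
-- completed at T is released no later than j, so it dominates j for both objectives.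
module Submission where

open import Defs
open import Data.Nat as ℕ using (ℕ; zero; suc; _+_; _*_; _∸_; _⊓_; _≤_; _<_; _>_; _≤?_; _<?_; z≤n; s≤s; >-nonZero)
open import Data.Nat.DivMod using (m/n*n≤m; m/n≤m; m≥n⇒m/n>0)
open import Data.Nat.ListAction using (sum)
open import Data.Nat.Properties
open import Data.Bool as Bool using (true)
open import Data.Fin as Fin using (Fin)
import Data.Fin.Properties as Fin
import Data.Integer as ℤ
import Data.Integer.Properties as ℤ
open import Data.List using (List; []; _∷_; map)
open import Data.List.Extrema ≤-totalOrder using (argmax; argmax-all; f[⊥]≤f[argmax]; f[xs]≤f[argmax])
open import Data.List.Relation.Unary.All as All using (All; []; _∷_)
open import Data.List.Relation.Unary.AllPairs using ([]; _∷_; uncons)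
open import Data.List.Relation.Unary.Unique.Propositional using (Unique)
open import Data.Product using (∃; _×_; _,_; proj₁; proj₂)
open import Data.Rational as ℚ using (ℚ; 0ℚ; 1ℚ; NonZero; _÷_; _-_) renaming (_≤_ to _≤ℚ_)
import Data.Rational.Properties as ℚ
import Data.Rational.Unnormalised as ℚᵘ
import Data.Rational.Unnormalised.Properties as ℚᵘ
open import Data.Sum using (_⊎_; inj₁; inj₂; [_,_]′)
open import Function using (_∘_; id)
open import Relation.Binary.PropositionalEquality
open import Relation.Nullary using (¬_; Dec; yes; no; contradiction)
open import Relation.Nullary.Decidable using (map′; _×-dec_)
open import Relation.Unary using (Decidable)

-- Natural numbers: least witnesses, finite bounds, sums over lists.

least : {P : ℕ → Set} → Decidable P → ∃ P → ∃ λ k → P k × (∀ i → P i → k ≤ i)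
least P? (n , pn) = search P? n pn
  where
  search : {P : ℕ → Set} → Decidable P → ∀ n → P n → ∃ λ k → P k × (∀ i → P i → k ≤ i)
  search P? n pn with P? 0
  search P? n       pn | yes p0 = 0 , p0 , λ _ _ → z≤n
  search P? zero    p0 | no ¬p0 = contradiction p0 ¬p0
  search P? (suc n) pn | no ¬p0 with search (P? ∘ suc) n pn
  ... | k , pk , k-min = suc k , pk , λ where
    zero    p0 → contradiction p0 ¬p0
    (suc i) pi → s≤s (k-min i pi)

bounded : ∀ {m} (f : Fin m → ℕ) → ∃ λ b → ∀ i → f i ≤ b
bounded {zero}  f = 0 , λ ()
bounded {suc m} f with bounded (f ∘ Fin.suc)
... | b , f≤b = f Fin.zero + b , λ where
  Fin.zero    → m≤m+n _ b
  (Fin.suc i) → ≤-trans (f≤b i) (m≤n+m b _)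

stationary : ∀ {A : Set} (p : ℕ → A) r → (∀ t → t < r → p (suc t) ≡ p t) →
             ∀ t → t ≤ r → p t ≡ p 0
stationary p r stays zero    _   = refl
stationary p r stays (suc t) t<r = trans (stays t t<r) (stationary p r stays t (<⇒≤ t<r))

offset : ∀ {s t} → s ≤ t → ∃ λ e → e + s ≡ t
offset {s} {t} s≤t = t ∸ s , m∸n+n≡m s≤t

module _ {A : Set} {f g : A → ℕ} where

  sum-map-mono : ∀ {xs} → All (λ x → f x ≤ g x) xs → sum (map f xs) ≤ sum (map g xs)
  sum-map-mono []            = z≤n
  sum-map-mono (fx≤gx ∷ f≤g) = +-mono-≤ fx≤gx (sum-map-mono f≤g)

  -- At most one entry drops, and only by one. If the head drops, uniqueness makes every later entry
  -- different from it, so none of them drops.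
  sum-map-suc : ∀ {xs} → (∀ x → f x ≤ suc (g x)) →
                (∀ {x y} → x ≢ y → g x < f x → f y ≤ g y) →
                Unique xs → sum (map f xs) ≤ suc (sum (map g xs))
  sum-map-suc f≤1+g one-drop [] = z≤n
  sum-map-suc {x ∷ xs} f≤1+g one-drop (x∉xs ∷ unique) with f x ≤? g x
  ... | yes fx≤gx = ≤-trans (+-mono-≤ fx≤gx (sum-map-suc f≤1+g one-drop unique))
                            (≤-reflexive (+-suc (g x) _))
  ... | no  fx≰gx =
    +-mono-≤ (f≤1+g x) (sum-map-mono (All.map (λ x≢y → one-drop x≢y (≰⇒> fx≰gx)) x∉xs))

sum-map-scale : ∀ {A : Set} {f g : A → ℕ} a b → (∀ x → a * f x ≤ b * g x) →
                ∀ xs → a * sum (map f xs) ≤ b * sum (map g xs)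
sum-map-scale a b af≤bg []       rewrite *-zeroʳ a = z≤n
sum-map-scale {f = f} {g} a b af≤bg (x ∷ xs)
  rewrite *-distribˡ-+ a (f x) (sum (map f xs)) | *-distribˡ-+ b (g x) (sum (map g xs)) =
  +-mono-≤ (af≤bg x) (sum-map-scale a b af≤bg xs)

-- Raising the cap from `a` to `b` enlarges the minimum by a factor of at most b/a. With `γ₀` and
-- `γ` as caps, this lets optimal work near the sink pay for greedy delay.
⊓-scale : ∀ {a b} d → a ≤ b → a * (d ⊓ b) ≤ b * (d ⊓ a)
⊓-scale {a} {b} d a≤b with ≤-total d a
... | inj₁ d≤a rewrite m≤n⇒m⊓n≡m d≤a = *-mono-≤ a≤b (m⊓n≤m d b)
... | inj₂ a≤d rewrite m≥n⇒m⊓n≡n a≤d | *-comm b a = *-monoʳ-≤ a (m⊓n≤n d b)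

-- Rational arithmetic: embedded naturals, ceilings, division by the speed.

toℚᵘ-toℚ : ∀ n → ℚ.toℚᵘ (toℚ n) ℚᵘ.≃ ℚᵘ.mkℚᵘ (ℤ.+ n) 0
toℚᵘ-toℚ n = ℚ.toℚᵘ-fromℚᵘ (ℚᵘ.mkℚᵘ (ℤ.+ n) 0)

toℚ-mono-≤ : ∀ {a b} → a ≤ b → toℚ a ≤ℚ toℚ b
toℚ-mono-≤ {a} {b} a≤b = ℚ.toℚᵘ-cancel-≤
  (ℚᵘ.≤-respˡ-≃ (ℚᵘ.≃-sym (toℚᵘ-toℚ a)) (ℚᵘ.≤-respʳ-≃ (ℚᵘ.≃-sym (toℚᵘ-toℚ b))
    (ℚᵘ.*≤* (ℤ.*-monoʳ-≤-nonNeg (ℤ.+ 1) (ℤ.+≤+ a≤b)))))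

toℚ-homo-+ : ∀ a b → toℚ (a + b) ≡ toℚ a ℚ.+ toℚ b
toℚ-homo-+ a b = ℚ.toℚᵘ-injective (begin
  ℚ.toℚᵘ (toℚ (a + b))                        ≈⟨ toℚᵘ-toℚ (a + b) ⟩
  ℚᵘ.mkℚᵘ (ℤ.+ (a + b)) 0                     ≈⟨ ℚᵘ.*≡* (cong (ℤ._* ℤ.+ 1)
                                                 (sym (cong₂ ℤ._+_ (ℤ.*-identityʳ (ℤ.+ a)) (ℤ.*-identityʳ (ℤ.+ b))))) ⟩
  ℚᵘ.mkℚᵘ (ℤ.+ a) 0 ℚᵘ.+ ℚᵘ.mkℚᵘ (ℤ.+ b) 0    ≈⟨ ℚᵘ.+-cong (toℚᵘ-toℚ a) (toℚᵘ-toℚ b) ⟨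
  ℚ.toℚᵘ (toℚ a) ℚᵘ.+ ℚ.toℚᵘ (toℚ b)          ≈⟨ ℚ.toℚᵘ-homo-+ (toℚ a) (toℚ b) ⟨
  ℚ.toℚᵘ (toℚ a ℚ.+ toℚ b)                    ∎)
  where open ℚᵘ.≃-Reasoning

toℚ-homo-* : ∀ a b → toℚ (a * b) ≡ toℚ a ℚ.* toℚ b
toℚ-homo-* a b = ℚ.toℚᵘ-injective (begin
  ℚ.toℚᵘ (toℚ (a * b))                        ≈⟨ toℚᵘ-toℚ (a * b) ⟩
  ℚᵘ.mkℚᵘ (ℤ.+ (a * b)) 0                     ≈⟨ ℚᵘ.*≡* (cong (ℤ._* ℤ.+ 1) (ℤ.pos-* a b)) ⟩
  ℚᵘ.mkℚᵘ (ℤ.+ a) 0 ℚᵘ.* ℚᵘ.mkℚᵘ (ℤ.+ b) 0    ≈⟨ ℚᵘ.*-cong (toℚᵘ-toℚ a) (toℚᵘ-toℚ b) ⟨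
  ℚ.toℚᵘ (toℚ a) ℚᵘ.* ℚ.toℚᵘ (toℚ b)          ≈⟨ ℚ.toℚᵘ-homo-* (toℚ a) (toℚ b) ⟨
  ℚ.toℚᵘ (toℚ a ℚ.* toℚ b)                    ∎)
  where open ℚᵘ.≃-Reasoning

toℚ-nonNeg : ∀ n → ℚ.NonNegative (toℚ n)
toℚ-nonNeg n = ℚ.nonNegative (toℚ-mono-≤ (z≤n {n}))

toℚ-pos : ∀ {n} → 0 < n → ℚ.Positive (toℚ n)
toℚ-pos 0<n = ℚ.positive (ℚ.<-≤-trans {0ℚ} {1ℚ} (ℚ.positive⁻¹ 1ℚ) (toℚ-mono-≤ 0<n))

fraction-*-denominator : ∀ a b .{{_ : ℕ.NonZero b}} → (ℤ.+ a ℚ./ b) ℚ.* toℚ b ≡ toℚ a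
fraction-*-denominator a b@(suc _) = ℚ.toℚᵘ-injective (begin
  ℚ.toℚᵘ ((ℤ.+ a ℚ./ b) ℚ.* toℚ b)            ≈⟨ ℚ.toℚᵘ-homo-* (ℤ.+ a ℚ./ b) (toℚ b) ⟩
  ℚ.toℚᵘ (ℤ.+ a ℚ./ b) ℚᵘ.* ℚ.toℚᵘ (toℚ b)    ≈⟨ ℚᵘ.*-cong (ℚ.toℚᵘ-fromℚᵘ (ℤ.+ a ℚᵘ./ b)) (toℚᵘ-toℚ b) ⟩
  (ℤ.+ a ℚᵘ./ b) ℚᵘ.* ℚᵘ.mkℚᵘ (ℤ.+ b) 0       ≈⟨ ℚᵘ.*≡* (ℤ.*-assoc (ℤ.+ a) (ℤ.+ b) (ℤ.+ 1)) ⟩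
  ℚᵘ.mkℚᵘ (ℤ.+ a) 0                           ≈⟨ toℚᵘ-toℚ a ⟨
  ℚ.toℚᵘ (toℚ a)                              ∎)
  where open ℚᵘ.≃-Reasoning

archimedean : ∀ q → ∃ λ n → q ≤ℚ toℚ n
archimedean q@(ℚ.mkℚ i d-1 _) = ℤ.∣ i ∣ , ℚ.toℚᵘ-cancel-≤
  (ℚᵘ.≤-respʳ-≃ (ℚᵘ.≃-sym (toℚᵘ-toℚ ℤ.∣ i ∣)) (ℚᵘ.*≤* (i≤∣i∣*d i)))
  where
  i≤∣i∣*d : ∀ i → i ℤ.* ℤ.+ 1 ℤ.≤ ℤ.+ ℤ.∣ i ∣ ℤ.* ℤ.+ suc d-1
  i≤∣i∣*d i@(ℤ.+ a) rewrite ℤ.*-identityʳ i | sym (ℤ.pos-* a (suc d-1)) = ℤ.+≤+ (m≤m*n a (suc d-1))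
  i≤∣i∣*d i@(ℤ.-[1+ a ]) rewrite ℤ.*-identityʳ i | sym (ℤ.pos-* (suc a) (suc d-1)) = ℤ.-≤+

-- Both directions together make `q ≤ t` equivalent to `c ≤ t` at every natural `t`, so that the
-- rational condition `ReleasedScaled` becomes a comparison of round numbers.
IsCeiling : ℚ → ℕ → Set
IsCeiling q c = (∀ t → q ≤ℚ toℚ t → c ≤ t) × (∀ t → c ≤ t → q ≤ℚ toℚ t)

-- Rounding up loses at most 1: the predecessor of the least upper natural fails to bound `q`, and
-- when there is no predecessor nonnegativity of `q` suffices.
ceiling-ℕ : ∀ q → ℚ.NonNegative q → ∃ λ c → IsCeiling q c × toℚ c ≤ℚ q ℚ.+ 1ℚ
ceiling-ℕ q q≥0 with least (λ t → q ℚ.≤? toℚ t) (archimedean q)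
... | c , q≤c , c-min =
  c , (c-min , λ t c≤t → ℚ.≤-trans q≤c (toℚ-mono-≤ c≤t)) , c≤q+1 c c-min
  where
  c≤q+1 : ∀ c → (∀ t → q ≤ℚ toℚ t → c ≤ t) → toℚ c ≤ℚ q ℚ.+ 1ℚ
  c≤q+1 zero    _     = ℚ.+-mono-≤ (ℚ.nonNegative⁻¹ q {{q≥0}}) (toℚ-mono-≤ (z≤n {1}))
  c≤q+1 (suc c) c-min = ℚ.≤-trans
    (ℚ.≤-reflexive (trans (cong toℚ (+-comm 1 c)) (toℚ-homo-+ c 1)))
    (ℚ.+-monoˡ-≤ 1ℚ (ℚ.<⇒≤ (ℚ.≰⇒> (λ q≤c → 1+n≰n (c-min c q≤c)))))

÷-≤ : ∀ {p q} σ .{{_ : ℚ.NonZero σ}} → ℚ.Positive σ → p ≤ℚ σ ℚ.* q → p ÷ σ ≤ℚ q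
÷-≤ {p} {q} σ σ>0 p≤σq = ℚ.*-cancelʳ-≤-pos σ {{σ>0}} (begin
  p ÷ σ ℚ.* σ            ≡⟨ ℚ.*-assoc p (ℚ.1/ σ) σ ⟩
  p ℚ.* (ℚ.1/ σ ℚ.* σ)   ≡⟨ cong (p ℚ.*_) (ℚ.*-inverseˡ σ) ⟩
  p ℚ.* 1ℚ               ≡⟨ ℚ.*-identityʳ p ⟩
  p                      ≤⟨ p≤σq ⟩
  σ ℚ.* q                ≡⟨ ℚ.*-comm σ q ⟩
  q ℚ.* σ                ∎)
  where open ℚ.≤-Reasoning

-- The shortest-path metric of a connected graph.

module Distance (G : Graph) (connected : Connected G) where
  open Graph G using (n; adj)

  adj-sym : ∀ {u v} → Adj G u v → Adj G v u
  adj-sym {u} {v} uv = trans (Graph.sym G v u) uv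

  _++ʷ_ : ∀ {u v w k l} → Walk G u v k → Walk G v w l → Walk G u w (k + l)
  here      ++ʷ q = q
  step uw p ++ʷ q = step uw (p ++ʷ q)

  reverse : ∀ {u v l} → Walk G u v l → Walk G v u l
  reverse here = here
  reverse (step {l = l} uw p) = subst (Walk G _ _) (+-comm l 1) (reverse p ++ʷ step (adj-sym uw) here)

  walk? : ∀ u v l → Dec (Walk G u v l)
  walk? u v zero    = map′ (λ { refl → here }) (λ { here → refl }) (u Fin.≟ v)
  walk? u v (suc l) = map′ (λ (_ , uw , p) → step uw p) (λ { (step uw p) → _ , uw , p })
    (Fin.any? (λ w → (adj u w Bool.≟ true) ×-dec walk? w v l))

  abstract
    distance : ∀ u v → ∃ (IsDist G u v)
    distance u v = least (walk? u v) (connected u v)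

  dist : Fin n → Fin n → ℕ
  dist u v = proj₁ (distance u v)

  shortest : ∀ u v → Walk G u v (dist u v)
  shortest u v = proj₁ (proj₂ (distance u v))

  dist-≤ : ∀ {u v l} → Walk G u v l → dist u v ≤ l
  dist-≤ {u} {v} p = proj₂ (proj₂ (distance u v)) _ p

  dist-unique : ∀ {u v d} → IsDist G u v d → d ≡ dist u v
  dist-unique (p , minimal) = ≤-antisym (minimal _ (shortest _ _)) (dist-≤ p)

  dist≤⇒DistLe : ∀ {u v k} → dist u v ≤ k → DistLe G u v k
  dist≤⇒DistLe {u} {v} d≤k = dist u v , proj₂ (distance u v) , d≤k

  DistLe⇒dist≤ : ∀ {u v k} → DistLe G u v k → dist u v ≤ k
  DistLe⇒dist≤ (d , isDist , d≤k) = subst (_≤ _) (dist-unique isDist) d≤k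

  triangle : ∀ u v w → dist u w ≤ dist u v + dist v w
  triangle u v w = dist-≤ (shortest u v ++ʷ shortest v w)

  dist-sym : ∀ u v → dist u v ≡ dist v u
  dist-sym u v = ≤-antisym (dist-≤ (reverse (shortest v u))) (dist-≤ (reverse (shortest u v)))

  dist-adj : ∀ {u v} w → Adj G u v → dist u w ≤ suc (dist v w)
  dist-adj w uv = dist-≤ (step uv (shortest _ w))

  dist-self : ∀ u → dist u u ≡ 0
  dist-self u = n≤0⇒n≡0 (dist-≤ here)

  dist-pos : ∀ {u v} → u ≢ v → 0 < dist u v
  dist-pos {u} {v} u≢v with dist u v | shortest u v
  ... | zero  | here = contradiction refl u≢v
  ... | suc _ | _    = s≤s z≤n

-- Paths of single packets towards the sink.

completion-unique : ∀ (I : Instance) pos j {c d} → Completion I pos j c → Completion I pos j d → c ≡ d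
completion-unique I pos j (at-c , before-c) (at-d , before-d) =
  ≤-antisym (≮⇒≥ λ d<c → before-c _ d<c at-d) (≮⇒≥ λ c<d → before-d _ c<d at-c)

module Gathering (I : Instance) (connected : Connected (Instance.graph I)) where
  open Instance I
  open Graph graph using (n)
  open Distance graph connected public

  depth : Fin n → ℕ
  depth v = dist v sink

  δ : Fin m → ℕ
  δ j = depth (origin j)

  depth-sink : ∀ {v} → v ≡ sink → depth v ≡ 0
  depth-sink refl = dist-self sink

  -- What the path of a packet in an arbitrary feasible schedule shares with its path in the greedy
  -- run: in each round it rests or crosses one edge, and the sink is absorbing.
  module Trajectory (p : ℕ → Fin n)
    (moves : ∀ t → p (suc t) ≡ p t ⊎ Adj graph (p t) (p (suc t)))
    (absorbed : ∀ t → p t ≡ sink → p (suc t) ≡ sink) where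

    depth-step : ∀ t → depth (p t) ≤ suc (depth (p (suc t)))
    depth-step t = [ (λ stay → subst (λ v → depth v ≤ suc (depth (p (suc t)))) stay (n≤1+n _))
                   , dist-adj sink ]′ (moves t)

    depth-lag : ∀ e t → depth (p t) ≤ e + depth (p (e + t))
    depth-lag zero    t = ≤-refl
    depth-lag (suc e) t = ≤-trans (depth-lag e t)
      (≤-trans (+-monoʳ-≤ e (depth-step (e + t))) (≤-reflexive (+-suc e _)))

    at-sink-since : ∀ {s t} → s ≤ t → p s ≡ sink → p t ≡ sink
    at-sink-since {s} s≤t ps with offset s≤t
    ... | e , refl = go e
      where
      go : ∀ e → p (e + s) ≡ sink
      go zero    = ps
      go (suc e) = absorbed (e + s) (go e)

    arrival-bound : ∀ {s t} → s ≤ t → p t ≡ sink → s + depth (p s) ≤ t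
    arrival-bound {s} s≤t pt with offset s≤t
    ... | e , refl = begin
      s + depth (p s)               ≤⟨ +-monoʳ-≤ s (depth-lag e s) ⟩
      s + (e + depth (p (e + s)))   ≡⟨ cong (λ d → s + (e + d)) (depth-sink pt) ⟩
      s + (e + 0)                   ≡⟨ cong (s +_) (+-identityʳ e) ⟩
      s + e                         ≡⟨ +-comm s e ⟩
      e + s                         ∎
      where open ≤-Reasoning

  -- Lower bound on the completion times of a feasible schedule.

  module Optimal (opt : Positions I) (feasible : Feasible I opt) where
    private
      start      = proj₁ feasible
      legal      = proj₁ (proj₂ feasible)
      compatible = proj₁ (proj₂ (proj₂ feasible))
      delivered  = proj₂ (proj₂ (proj₂ feasible))

    module Path (j : Fin m) = Trajectory (λ t → opt t j)
      (λ t → [ inj₁ , (λ (uv , _) → inj₂ uv) ]′ (legal t j))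
      (λ t at-sink → [ (λ stay → trans stay at-sink)
                     , (λ (_ , _ , not-sink) → contradiction at-sink not-sink) ]′ (legal t j))

    at-origin : ∀ j t → t ≤ release j → opt t j ≡ origin j
    at-origin j t t≤r = trans (stationary (λ t → opt t j) (release j) stays t t≤r) (start j)
      where
      stays : ∀ t → t < release j → opt (suc t) j ≡ opt t j
      stays t t<r = [ (λ stay → stay) , (λ (_ , r≤t , _) → contradiction r≤t (<⇒≱ t<r)) ]′ (legal t j)

    completion : ∀ j → ∃ (Completion I opt j)
    completion j with least (λ t → opt t j Fin.≟ sink) (delivered j)
    ... | c , at-sink , c-min = c , at-sink , λ t t<c at-sink′ → <⇒≱ t<c (c-min t at-sink′)

    release-before : ∀ {j t} → origin j ≢ sink → opt t j ≡ sink → release j ≤ t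
    release-before {j} {t} o≢s at-sink =
      ≮⇒≥ λ t<r → o≢s (trans (sym (at-origin j t (<⇒≤ t<r))) at-sink)

    module Critical (g : ℕ) (g+g≤1+dI : g + g ≤ suc dI) where

      -- Hops still to be made within distance `g` of the sink. The cap keeps the value at `g` as
      -- long as the packet is farther out.
      height : ℕ → Fin m → ℕ
      height t j = depth (opt t j) ⊓ g

      height-step : ∀ t j → height t j ≤ suc (height (suc t) j)
      height-step t j = ⊓-mono-≤ (Path.depth-step j t) (n≤1+n g)

      -- The cap `g` cannot be undercut unless the new position lies strictly inside radius `g`; the
      -- old position is one hop away, hence still within `g`.
      descent : ∀ {t j} → height (suc t) j < height t j →
                Moves I opt t j × depth (opt t j) ≤ g × depth (opt (suc t) j) < g
      descent {t} {j} drop = moved , ≤-trans (Path.depth-step j t) below , below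
        where
        below : depth (opt (suc t) j) < g
        below = ≰⇒> λ g≤d → <⇒≱ drop (≤-trans (m⊓n≤n _ g) (≤-reflexive (sym (m≥n⇒m⊓n≡n g≤d))))

        moved : Moves I opt t j
        moved stay = <⇒≢ drop (cong (λ v → depth v ⊓ g) stay)

      -- Two calls descending within distance g of the sink interfere, since
      -- the sender of one is within g + (g ∸ 1) ≤ dI of the receiver of the other.
      one-descent : ∀ t {j k} → j ≢ k → height (suc t) j < height t j → height t k ≤ height (suc t) k
      one-descent t {j} {k} j≢k drop-j = ≮⇒≥ λ drop-k → conflict (descent drop-j) (descent drop-k)
        where
        conflict : Moves I opt t j × depth (opt t j) ≤ g × depth (opt (suc t) j) < g →
                   ¬ (Moves I opt t k × depth (opt t k) ≤ g × depth (opt (suc t) k) < g)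
        conflict (moves-j , _ , v<g) (moves-k , u≤g , _) =
          compatible t j k j≢k moves-j moves-k (inj₁ (dist≤⇒DistLe (≤-pred (begin
            suc (dist u v)                  ≤⟨ s≤s (triangle u sink v) ⟩
            suc (depth u + dist sink v)     ≡⟨ cong (λ d → suc (depth u + d)) (dist-sym sink v) ⟩
            suc (depth u + depth v)         ≡⟨ +-suc (depth u) (depth v) ⟨
            depth u + suc (depth v)         ≤⟨ +-mono-≤ u≤g v<g ⟩
            g + g                           ≤⟨ g+g≤1+dI ⟩
            suc dI                          ∎))))
          where
          open ≤-Reasoning
          u = opt t k
          v = opt (suc t) j

      total-lag : ∀ {xs} → Unique xs → ∀ e t →
                  sum (map (height t) xs) ≤ e + sum (map (height (e + t)) xs)
      total-lag unique zero    t = ≤-refl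
      total-lag unique (suc e) t = ≤-trans (total-lag unique e t)
        (≤-trans (+-monoʳ-≤ e (sum-map-suc (height-step (e + t)) (one-descent (e + t)) unique))
                 (≤-reflexive (+-suc e _)))

      -- At time `r` every listed packet is still at its origin, at time `t` every height is 0, and
      -- in between the total height falls by at most one per round.
      workload-bound : ∀ {r t xs} → Unique xs → r ≤ t → All (λ j → r ≤ release j) xs →
                       All (λ j → opt t j ≡ sink) xs → r + sum (map (λ j → δ j ⊓ g) xs) ≤ t
      workload-bound {r} {t} {xs} unique r≤t released arrived with offset r≤t
      ... | e , refl = begin
        r + sum (map (λ j → δ j ⊓ g) xs)              ≤⟨ +-monoʳ-≤ r (sum-map-mono (All.map initial released)) ⟩
        r + sum (map (height r) xs)                   ≤⟨ +-monoʳ-≤ r (total-lag unique e r) ⟩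
        r + (e + sum (map (height (e + r)) xs))       ≤⟨ +-monoʳ-≤ r (+-monoʳ-≤ e (sum-map-mono (All.map final arrived))) ⟩
        r + (e + sum (map (λ _ → 0) xs))              ≡⟨ cong (λ z → r + (e + z)) (sum-zeros xs) ⟩
        r + (e + 0)                                   ≡⟨ cong (r +_) (+-identityʳ e) ⟩
        r + e                                         ≡⟨ +-comm r e ⟩
        e + r                                         ∎
        where
        open ≤-Reasoning
        initial : ∀ {j} → r ≤ release j → δ j ⊓ g ≤ height r j
        initial {j} r≤rj = ≤-reflexive (cong (λ v → depth v ⊓ g) (sym (at-origin j r r≤rj)))
        final : ∀ {j} → opt (e + r) j ≡ sink → height (e + r) j ≤ 0
        final at-sink = ≤-trans (m⊓n≤m _ g) (≤-reflexive (depth-sink at-sink))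
        sum-zeros : ∀ xs → sum (map (λ _ → 0) xs) ≡ 0
        sum-zeros []       = refl
        sum-zeros (_ ∷ xs) = sum-zeros xs

  -- Upper bound on the completion times of the greedy run.

  module Greedy (σ : ℚ) (prio : Fin m → ℕ) (pos : Positions I) (run : GreedyRun I σ prio pos)
    (R : Fin m → ℕ) (R-ceiling : ∀ j → IsCeiling (σ ℚ.* toℚ (release j)) (R j)) where

    private
      starts = proj₁ run
      waits  = proj₁ (proj₂ run)
      greedy = proj₂ (proj₂ run)

      R-least : ∀ j t → ReleasedScaled I σ t j → R j ≤ t
      R-least j = proj₁ (R-ceiling j)

      R-released : ∀ j t → R j ≤ t → ReleasedScaled I σ t j
      R-released j = proj₂ (R-ceiling j)

    data Step (t : ℕ) (j : Fin m) : Set where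
      idle     : pos (suc t) j ≡ pos t j → t < R j ⊎ pos t j ≡ sink → Step t j
      advances : Adj graph (pos t j) (pos (suc t) j) →
                 depth (pos (suc t) j) < depth (pos t j) → Step t j
      blocked  : pos (suc t) j ≡ pos t j → ∀ {k v} → prio k > prio j → Moves I pos t k →
                 Adj graph (pos t j) v → Interfere graph dI (callOf I pos t k) (pos t j , v) →
                 Step t j

    step-of : ∀ t j → Step t j
    step-of t j with R j ≤? t | pos t j Fin.≟ sink
    ... | no  R≰t | _ = idle (waits t j (λ (released , _) → R≰t (R-least j t released))) (inj₁ (≰⇒> R≰t))
    ... | yes _   | yes at-sink = idle (waits t j (λ (_ , not-sink) → not-sink at-sink)) (inj₂ at-sink)
    ... | yes R≤t | no not-sink with greedy t j (R-released j t R≤t) not-sink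
    ...   | v , (uv , _ , _ , du , dv , dv<du) , inj₁ (refl , _) =
      advances uv (subst₂ _<_ (dist-unique dv) (dist-unique du) dv<du)
    ...   | v , (uv , _) , inj₂ (stay , k , k>j , moves , interfere) = blocked stay k>j moves uv interfere

    legal : ∀ t j → pos (suc t) j ≡ pos t j ⊎ Adj graph (pos t j) (pos (suc t) j)
    legal t j with step-of t j
    ... | idle stay _          = inj₁ stay
    ... | advances uv _        = inj₂ uv
    ... | blocked stay _ _ _ _ = inj₁ stay

    sink-waits : ∀ t j → pos t j ≡ sink → pos (suc t) j ≡ pos t j
    sink-waits t j at-sink = waits t j (λ (_ , not-sink) → not-sink at-sink)

    module Path (j : Fin m) = Trajectory (λ t → pos t j) (λ t → legal t j)
      (λ t at-sink → trans (sink-waits t j at-sink) at-sink)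

    at-origin : ∀ j t → t ≤ R j → pos t j ≡ origin j
    at-origin j t t≤R = trans (stationary (λ t → pos t j) (R j) stays t t≤R) (starts j)
      where
      stays : ∀ t → t < R j → pos (suc t) j ≡ pos t j
      stays t t<R = waits t j (λ (released , _) → <⇒≱ t<R (R-least j t released))

    depth-antitone : ∀ t j → depth (pos (suc t) j) ≤ depth (pos t j)
    depth-antitone t j with step-of t j
    ... | idle stay _          = ≤-reflexive (cong depth stay)
    ... | advances _ closer    = <⇒≤ closer
    ... | blocked stay _ _ _ _ = ≤-reflexive (cong depth stay)

    depth≤δ : ∀ t j → depth (pos t j) ≤ δ j
    depth≤δ zero    j = ≤-reflexive (cong depth (starts j))
    depth≤δ (suc t) j = ≤-trans (depth-antitone t j) (depth≤δ t j)

    -- Interference puts the sender of one call within `dI` of the receiver of the other; crossing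
    -- the edge of the latter call adds one hop.
    interfere⇒depth : ∀ {t k u v} → Moves I pos t k → Adj graph u v →
                      Interfere graph dI (callOf I pos t k) (u , v) →
                      depth u ≤ depth (pos t k) + suc dI
    interfere⇒depth {t} {k} {u} {v} moves uv interfere =
      ≤-trans (close interfere) (≤-reflexive (trans (cong suc (+-comm dI _)) (sym (+-suc _ dI))))
      where
      open ≤-Reasoning
      call : Adj graph (pos t k) (pos (suc t) k)
      call = [ (λ stay → contradiction stay moves) , id ]′ (legal t k)
      close : Interfere graph dI (callOf I pos t k) (u , v) → depth u ≤ suc (dI + depth (pos t k))
      close (inj₁ near) = begin
        depth u                                               ≤⟨ triangle u (pos (suc t) k) sink ⟩
        dist u (pos (suc t) k) + depth (pos (suc t) k)        ≤⟨ +-mono-≤ (DistLe⇒dist≤ near) (dist-adj sink (adj-sym call)) ⟩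
        dI + suc (depth (pos t k))                            ≡⟨ +-suc dI _ ⟩
        suc (dI + depth (pos t k))                            ∎
      close (inj₂ near) = begin
        depth u                                               ≤⟨ dist-adj sink uv ⟩
        suc (depth v)                                         ≤⟨ s≤s (triangle v (pos t k) sink) ⟩
        suc (dist v (pos t k) + depth (pos t k))              ≡⟨ cong (λ d → suc (d + _)) (dist-sym v (pos t k)) ⟩
        suc (dist (pos t k) v + depth (pos t k))              ≤⟨ s≤s (+-monoˡ-≤ _ (DistLe⇒dist≤ near)) ⟩
        suc (dI + depth (pos t k))                            ∎

    moves⇒not-sink : ∀ {t k} → Moves I pos t k → pos t k ≢ sink
    moves⇒not-sink {t} {k} moves at-sink = moves (sink-waits t k at-sink)

    -- Invariant for the projected arrival `t + depth (pos t j)`. The left case holds while `j` has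
    -- not been blocked since its release; in the right case `k` is the most recent blocker. That
    -- `k` starts off the sink is recorded so that `k` has a chain of its own.
    Deadline : Fin m → ℕ → Set
    Deadline j D = D ≤ R j + δ j
      ⊎ ∃ λ k → prio k > prio j × origin k ≢ sink
        × ∃ λ c → Completion I pos k c × D ≤ c + (δ j ⊓ γ dI)

    Deadline-antitone : ∀ {j D D′} → D′ ≤ D → Deadline j D → Deadline j D′
    Deadline-antitone D′≤D (inj₁ D≤) = inj₁ (≤-trans D′≤D D≤)
    Deadline-antitone D′≤D (inj₂ (k , k>j , k≢s , c , done , D≤)) =
      inj₂ (k , k>j , k≢s , c , done , ≤-trans D′≤D D≤)

    -- After being blocked by k, packet j trails k by at most dI + 1 hops, and
    -- both then need at least as many rounds as their distance to the sink.
    blocked-deadline : ∀ {t j k v c} → prio k > prio j → Moves I pos t k → Adj graph (pos t j) v →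
      Interfere graph dI (callOf I pos t k) (pos t j , v) → Completion I pos k c →
      Deadline j (suc t + depth (pos t j))
    blocked-deadline {t} {j} {k} {v} {c} k>j moves uv interfere (at-c , before-c) =
      inj₂ (k , k>j , k-origin , c , (at-c , before-c) ,
        subst (suc t + depth (pos t j) ≤_) (sym (+-distribˡ-⊓ c (δ j) (γ dI))) (⊓-glb by-δ by-γ))
      where
      open ≤-Reasoning
      not-sink : pos t k ≢ sink
      not-sink = moves⇒not-sink moves
      k-origin : origin k ≢ sink
      k-origin o≡s = not-sink (Path.at-sink-since k (z≤n {t}) (trans (starts k) o≡s))
      arrival : t + depth (pos t k) ≤ c
      arrival = Path.arrival-bound k (≮⇒≥ λ c<t → not-sink (Path.at-sink-since k (<⇒≤ c<t) at-c)) at-c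
      by-δ : suc t + depth (pos t j) ≤ c + δ j
      -- Since `k` is still off the sink at time `t`, it completes no earlier than `suc t`; greedy
      -- never increases the distance of `j`.
      by-δ = +-mono-≤ (≤-trans (m<m+n t (dist-pos not-sink)) arrival) (depth≤δ t j)
      by-γ : suc t + depth (pos t j) ≤ c + γ dI
      -- The gap of `dI + 1` hops and the one lost round add up to `γ dI`.
      by-γ = begin
        suc t + depth (pos t j)                 ≤⟨ +-monoʳ-≤ (suc t) (interfere⇒depth moves uv interfere) ⟩
        suc t + (depth (pos t k) + suc dI)      ≡⟨ +-suc t _ ⟨
        t + suc (depth (pos t k) + suc dI)      ≡⟨ cong (t +_) (+-suc _ (suc dI)) ⟨
        t + (depth (pos t k) + suc (suc dI))    ≡⟨ +-assoc t _ _ ⟨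
        t + depth (pos t k) + suc (suc dI)      ≤⟨ +-mono-≤ arrival (≤-reflexive (+-comm 2 dI)) ⟩
        c + γ dI                                ∎

    module _ (j : Fin m) (higher-done : ∀ k → prio k > prio j → ∃ (Completion I pos k)) where

      -- Delivery by the greedy run is not assumed but proved. The finitely many completion times of
      -- higher-priority packets bound every deadline of `j`, which supplies the fuel for `arrive`.
      deadline-bounded : ∃ λ B → ∀ D → Deadline j D → D ≤ B
      deadline-bounded = R j + δ j + proj₁ common , λ where
          D (inj₁ D≤) → ≤-trans D≤ (m≤m+n _ _)
          D (inj₂ (k , k>j , _ , c , done , D≤)) →
            ≤-trans (≤-trans (proj₂ (after k) D c k>j done D≤) (proj₂ common k)) (m≤n+m _ _)
        where
        after : ∀ k → ∃ λ b → ∀ D c → prio k > prio j → Completion I pos k c → D ≤ c + (δ j ⊓ γ dI) → D ≤ b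
        after k with prio j <? prio k
        -- Packets that cannot delay `j` contribute the default 0.
        ... | no  k≯j = 0 , λ _ _ k>j → contradiction k>j k≯j
        ... | yes k>j with higher-done k k>j
        ...   | c′ , done′ = c′ + (δ j ⊓ γ dI) , λ D c _ done →
          subst (λ c → D ≤ c + (δ j ⊓ γ dI)) (completion-unique I pos k done done′)
        common = bounded (proj₁ ∘ after)

      -- Follows `j` round by round. An advance does not increase the projected arrival, and a block
      -- replaces its deadline by one from the new blocker. Fuel cannot run out off the sink,
      -- because the current time would then exceed the bound on all deadlines.
      arrive : ∀ fuel t → proj₁ deadline-bounded < t + fuel → R j ≤ t →
               (∀ s → s < t → pos s j ≢ sink) → Deadline j (t + depth (pos t j)) →
               ∃ λ c → Completion I pos j c × Deadline j c
      arrive fuel t B< R≤t before deadline with pos t j Fin.≟ sink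
      ... | yes at-sink = t , (at-sink , before) , Deadline-antitone (m≤m+n t _) deadline
      arrive zero t B< R≤t before deadline | no _ = contradiction
        (≤-trans (m≤m+n t _) (proj₂ deadline-bounded _ deadline))
        (<⇒≱ (subst (proj₁ deadline-bounded <_) (+-identityʳ t) B<))
      arrive (suc fuel) t B< R≤t before deadline | no not-sink =
        arrive fuel (suc t) (subst (proj₁ deadline-bounded <_) (+-suc t fuel) B<) (m≤n⇒m≤1+n R≤t)
          before′ (next (step-of t j))
        where
        before′ : ∀ s → s < suc t → pos s j ≢ sink
        before′ s s<1+t with m<1+n⇒m<n∨m≡n s<1+t
        ... | inj₁ s<t  = before s s<t
        ... | inj₂ refl = not-sink
        next : Step t j → Deadline j (suc t + depth (pos (suc t) j))
        next (idle _ (inj₁ t<R))     = contradiction R≤t (<⇒≱ t<R)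
        next (idle _ (inj₂ at-sink)) = contradiction at-sink not-sink
        next (advances _ closer)     =
          Deadline-antitone (≤-trans (≤-reflexive (sym (+-suc t _))) (+-monoʳ-≤ t closer)) deadline
        next (blocked stay {k} k>j moves uv interfere) =
          subst (λ u → Deadline j (suc t + depth u)) (sym stay)
            (blocked-deadline k>j moves uv interfere (proj₂ (higher-done k k>j)))

      deliver : ∃ λ c → Completion I pos j c × (origin j ≢ sink → Deadline j c)
      deliver with origin j Fin.≟ sink
      -- A packet originating at the sink completes at time 0, even before its release, and needs no
      -- deadline.
      ... | yes o≡s = 0 , (trans (starts j) o≡s , λ _ ()) , λ o≢s → contradiction o≡s o≢s
      ... | no  o≢s = let c , done , deadline = arrive (suc (proj₁ deadline-bounded)) (R j)
                            (m≤n+m _ (R j)) ≤-refl before (inj₁ (+-monoʳ-≤ (R j) (depth≤δ (R j) j)))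
                      in  c , done , λ _ → deadline
        where
        before : ∀ s → s < R j → pos s j ≢ sink
        before s s<R at-sink = o≢s (trans (sym (at-origin j s (<⇒≤ s<R))) at-sink)

    -- Under FIFO, `above` dates all releases no later than that of `j`, and `below` no earlier than
    -- that of `last`. Only `last` contributes its full distance; `unique` is what allows the
    -- workload to be summed over the chain.
    record Chain (j : Fin m) (c : ℕ) : Set where
      field
        last        : Fin m
        delayed     : List (Fin m)
        unique      : Unique (last ∷ delayed)
        above       : All (λ x → prio j ≤ prio x) (last ∷ delayed)
        below       : All (λ x → prio x ≤ prio last) delayed
        last-moves  : origin last ≢ sink
        bound       : c ≤ R last + δ last + sum (map (λ x → δ x ⊓ γ dI) delayed)

    -- Every member of the chain of `k` has strictly higher priority than `j`, so `j` is new to the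
    -- chain and lies below `last`.
    extend : ∀ {j k c D} → prio k > prio j → D ≤ c + (δ j ⊓ γ dI) → Chain k c → Chain j D
    extend {j} {k} {c} {D} k>j D≤ chain = record
      { last       = last
      ; delayed    = j ∷ delayed
      ; unique     = ((λ l≡j → proj₁ (All.uncons distinct) (sym l≡j)) ∷ proj₁ (uncons unique))
                     ∷ (proj₂ (All.uncons distinct) ∷ proj₂ (uncons unique))
      ; above      = proj₁ (All.uncons higher) ∷ ≤-refl ∷ proj₂ (All.uncons higher)
      ; below      = proj₁ (All.uncons higher) ∷ below
      ; last-moves = last-moves
      ; bound      = begin
          D                                                   ≤⟨ D≤ ⟩
          c + w j                                             ≤⟨ +-monoˡ-≤ (w j) bound ⟩
          R last + δ last + sum (map w delayed) + w j         ≡⟨ +-assoc (R last + δ last) _ _ ⟩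
          R last + δ last + (sum (map w delayed) + w j)       ≡⟨ cong (R last + δ last +_) (+-comm _ (w j)) ⟩
          R last + δ last + (w j + sum (map w delayed))       ∎
      }
      where
      open Chain chain
      open ≤-Reasoning
      w : Fin m → ℕ
      w x = δ x ⊓ γ dI
      higher : All (λ x → prio j ≤ prio x) (last ∷ delayed)
      higher = All.map (≤-trans (<⇒≤ k>j)) above
      distinct : All (j ≢_) (last ∷ delayed)
      distinct = All.map (λ k≤x j≡x → <⇒≱ k>j (≤-trans k≤x (≤-reflexive (cong prio (sym j≡x))))) above

    -- Induction from the highest priority downwards, with delivery and chain obtained together: a
    -- blocker of `j` has already been treated, and its chain is prolonged by `j`.
    completion-chain : ∀ j → ∃ λ c → Completion I pos j c × (origin j ≢ sink → Chain j c)
    completion-chain j = descend (suc M) j (m≤n+m (suc M) (prio j))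
      where
      M = proj₁ (bounded prio)
      -- `n` exceeds the distance from `prio j` up to the bound `M`, and can decrease by one at each
      -- rise in priority.
      descend : ∀ n j → M < prio j + n → ∃ λ c → Completion I pos j c × (origin j ≢ sink → Chain j c)
      descend zero    j M< = contradiction (proj₂ (bounded prio) j)
                               (<⇒≱ (subst (M <_) (+-identityʳ (prio j)) M<))
      descend (suc n) j M< = c , done , λ o≢s → chain o≢s (deadline o≢s)
        where
        higher : ∀ k → prio k > prio j → ∃ λ c → Completion I pos k c × (origin k ≢ sink → Chain k c)
        higher k k>j = descend n k (≤-trans M< (≤-trans (≤-reflexive (+-suc (prio j) n)) (+-monoˡ-≤ n k>j)))
        delivery = deliver j (λ k k>j → let c , done , _ = higher k k>j in c , done)
        c        = proj₁ delivery
        done     = proj₁ (proj₂ delivery)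
        deadline = proj₂ (proj₂ delivery)
        chain : origin j ≢ sink → Deadline j c → Chain j c
        chain o≢s (inj₁ c≤) = record
          { last = j ; delayed = [] ; unique = [] ∷ [] ; above = ≤-refl ∷ [] ; below = []
          ; last-moves = o≢s ; bound = ≤-trans c≤ (m≤m+n _ 0) }
        chain o≢s (inj₂ (k , k>j , k≢s , c′ , done′ , c≤)) =
          let c″ , done″ , chain-k = higher k k>j
          in  extend k>j (subst (λ x → c ≤ x + (δ j ⊓ γ dI)) (completion-unique I pos k done′ done″) c≤)
                (chain-k k≢s)

-- The constants `γ` and `γ₀`, and the arithmetic of the speed threshold.

γ₀+γ₀≤1+d : ∀ d → γ₀ d + γ₀ d ≤ suc d
γ₀+γ₀≤1+d d = begin
  γ₀ d + γ₀ d   ≡⟨ cong (γ₀ d +_) (+-identityʳ (γ₀ d)) ⟨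
  2 * γ₀ d      ≡⟨ *-comm 2 (γ₀ d) ⟩
  γ₀ d * 2      ≤⟨ m/n*n≤m (d + 1) 2 ⟩
  d + 1         ≡⟨ +-comm d 1 ⟩
  suc d         ∎
  where open ≤-Reasoning

γ₀≤γ : ∀ d → γ₀ d ≤ γ d
γ₀≤γ d = ≤-trans (m/n≤m (d + 1) 2) (+-monoʳ-≤ d (s≤s z≤n))

γ₀-pos : ∀ {d} → 1 ≤ d → 0 < γ₀ d
γ₀-pos {d} 1≤d = m≥n⇒m/n>0 (+-monoˡ-≤ 1 1≤d)

-- The hypothesis is `e ≤ (γ/γ₀ + 1) a` with the denominator `γ₀` cleared.
speed-suffices : ∀ {d σ a e} → 1 ≤ d → speedThreshold d ≤ℚ σ →
                 γ₀ d * e ≤ (γ d + γ₀ d) * a → toℚ e ≤ℚ σ ℚ.* toℚ a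
speed-suffices {d@(suc _)} {σ} {a} {e} 1≤d threshold≤σ ge≤ = ℚ.≤-trans
  (ℚ.*-cancelʳ-≤-pos (toℚ (γ₀ d)) {{toℚ-pos (γ₀-pos 1≤d)}} (begin
    toℚ e ℚ.* toℚ (γ₀ d)                                 ≡⟨ toℚ-homo-* e (γ₀ d) ⟨
    toℚ (e * γ₀ d)                                       ≤⟨ toℚ-mono-≤ (≤-trans (≤-reflexive (*-comm e (γ₀ d))) ge≤) ⟩
    toℚ ((γ d + γ₀ d) * a)                               ≡⟨ toℚ-homo-* (γ d + γ₀ d) a ⟩
    toℚ (γ d + γ₀ d) ℚ.* toℚ a                           ≡⟨ cong (ℚ._* toℚ a) (toℚ-homo-+ (γ d) (γ₀ d)) ⟩
    (toℚ (γ d) ℚ.+ toℚ (γ₀ d)) ℚ.* toℚ a                 ≡⟨ cong (ℚ._* toℚ a) (cong₂ ℚ._+_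
                                                              (fraction-*-denominator (γ d) (γ₀ d))
                                                              (ℚ.*-identityˡ (toℚ (γ₀ d)))) ⟨
    (ρ ℚ.* toℚ (γ₀ d) ℚ.+ 1ℚ ℚ.* toℚ (γ₀ d)) ℚ.* toℚ a   ≡⟨ cong (ℚ._* toℚ a) (ℚ.*-distribʳ-+ (toℚ (γ₀ d)) ρ 1ℚ) ⟨
    (ρ ℚ.+ 1ℚ) ℚ.* toℚ (γ₀ d) ℚ.* toℚ a                  ≡⟨ ℚ.*-assoc (ρ ℚ.+ 1ℚ) _ _ ⟩
    (ρ ℚ.+ 1ℚ) ℚ.* (toℚ (γ₀ d) ℚ.* toℚ a)                ≡⟨ cong ((ρ ℚ.+ 1ℚ) ℚ.*_) (ℚ.*-comm (toℚ (γ₀ d)) (toℚ a)) ⟩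
    (ρ ℚ.+ 1ℚ) ℚ.* (toℚ a ℚ.* toℚ (γ₀ d))                ≡⟨ ℚ.*-assoc (ρ ℚ.+ 1ℚ) _ _ ⟨
    (ρ ℚ.+ 1ℚ) ℚ.* toℚ a ℚ.* toℚ (γ₀ d)                  ∎))
  (ℚ.*-monoʳ-≤-nonNeg (toℚ a) {{toℚ-nonNeg a}} threshold≤σ)
  where
  open ℚ.≤-Reasoning
  instance _ = >-nonZero (γ₀-pos 1≤d)
  ρ : ℚ
  ρ = ℤ.+ γ d ℚ./ γ₀ d

threshold-pos : ∀ {d σ} → 1 ≤ d → speedThreshold d ≤ℚ σ → ℚ.Positive σ
threshold-pos {d} {σ} 1≤d threshold≤σ = ℚ.positive (ℚ.<-≤-trans (ℚ.positive⁻¹ 1ℚ)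
  -- Taking both naturals to be 1 gives `1 ≤ σ`.
  (subst (1ℚ ≤ℚ_) (ℚ.*-identityʳ σ) (speed-suffices {a = 1} {e = 1} 1≤d threshold≤σ
    (*-monoˡ-≤ 1 (m≤n+m (γ₀ d) (γ d))))))

-- The term a ≥ 1 of the workload pays for the round lost by rounding a release date up.
chain-arithmetic : ∀ {g G a s x y A} → g ≤ G → 1 ≤ a → a + s ≤ A → x ≤ A → g * y ≤ G * s →
                   g * suc (x + y) ≤ (G + g) * A
chain-arithmetic {g} {G} {a} {s} {x} {y} {A} g≤G 1≤a a+s≤A x≤A gy≤Gs = begin
  g * suc (x + y)           ≡⟨ *-suc g (x + y) ⟩
  g + g * (x + y)           ≡⟨ cong (g +_) (*-distribˡ-+ g x y) ⟩
  g + (g * x + g * y)       ≤⟨ +-mono-≤ g≤G (+-mono-≤ (*-monoʳ-≤ g x≤A) gy≤Gs) ⟩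
  G + (g * A + G * s)       ≡⟨ cong (G +_) (+-comm (g * A) (G * s)) ⟩
  G + (G * s + g * A)       ≡⟨ +-assoc G _ _ ⟨
  G + G * s + g * A         ≡⟨ cong (_+ g * A) (*-suc G s) ⟨
  G * suc s + g * A         ≤⟨ +-monoˡ-≤ (g * A) (*-monoʳ-≤ G (≤-trans (+-monoˡ-≤ s 1≤a) a+s≤A)) ⟩
  G * A + g * A             ≡⟨ *-distribʳ-+ A G g ⟨
  (G + g) * A               ∎
  where open ≤-Reasoning

-- The 1 lost by rounding the release up is moved into `suc x`, and `σ T` splits at the release into
-- `σ r` and `σ A`.
scale-bound : ∀ {σ R r c x A T} → toℚ R ≤ℚ σ ℚ.* toℚ r ℚ.+ 1ℚ → c ≤ R + x →
              toℚ (suc x) ≤ℚ σ ℚ.* toℚ A → r + A ≡ T → toℚ c ≤ℚ σ ℚ.* toℚ T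
scale-bound {σ} {R} {r} {c} {x} {A} R≤ c≤R+x x<σA refl = begin
  toℚ c                                       ≤⟨ toℚ-mono-≤ c≤R+x ⟩
  toℚ (R + x)                                 ≡⟨ toℚ-homo-+ R x ⟩
  toℚ R ℚ.+ toℚ x                             ≤⟨ ℚ.+-monoˡ-≤ (toℚ x) R≤ ⟩
  σ ℚ.* toℚ r ℚ.+ 1ℚ ℚ.+ toℚ x                ≡⟨ ℚ.+-assoc (σ ℚ.* toℚ r) 1ℚ (toℚ x) ⟩
  σ ℚ.* toℚ r ℚ.+ (1ℚ ℚ.+ toℚ x)              ≡⟨ cong (σ ℚ.* toℚ r ℚ.+_) (toℚ-homo-+ 1 x) ⟨
  σ ℚ.* toℚ r ℚ.+ toℚ (suc x)                 ≤⟨ ℚ.+-monoʳ-≤ (σ ℚ.* toℚ r) x<σA ⟩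
  σ ℚ.* toℚ r ℚ.+ σ ℚ.* toℚ A                 ≡⟨ ℚ.*-distribˡ-+ σ (toℚ r) (toℚ A) ⟨
  σ ℚ.* (toℚ r ℚ.+ toℚ A)                     ≡⟨ cong (σ ℚ.*_) (toℚ-homo-+ r A) ⟨
  σ ℚ.* toℚ (r + A)                           ∎
  where open ℚ.≤-Reasoning

-- Comparison of the FIFO run with a feasible schedule.

module Comparison (I : Instance) (1≤dI : 1 ≤ Instance.dI I) (connected : Connected (Instance.graph I))
  (σ : ℚ) (threshold≤σ : speedThreshold (Instance.dI I) ≤ℚ σ)
  (prio : Fin (Instance.m I) → ℕ) (fifo-prio : FIFOPriority I prio)
  (fifo : Positions I) (run : GreedyRun I σ prio fifo)
  (opt : Positions I) (feasible : Feasible I opt) where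

  open Instance I
  open Gathering I connected
  open Optimal opt feasible
  open Critical (γ₀ dI) (γ₀+γ₀≤1+d dI)

  σ>0 : ℚ.Positive σ
  σ>0 = threshold-pos 1≤dI threshold≤σ

  scaled-release : ∀ j → ∃ λ c → IsCeiling (σ ℚ.* toℚ (release j)) c ×
                   toℚ c ≤ℚ σ ℚ.* toℚ (release j) ℚ.+ 1ℚ
  scaled-release j = ceiling-ℕ (σ ℚ.* toℚ (release j))
    (ℚ.nonNeg*nonNeg⇒nonNeg σ {{ℚ.pos⇒nonNeg σ {{σ>0}}}} (toℚ (release j)) {{toℚ-nonNeg (release j)}})

  R : Fin m → ℕ
  R j = proj₁ (scaled-release j)

  R≤ : ∀ j → toℚ (R j) ≤ℚ σ ℚ.* toℚ (release j) ℚ.+ 1ℚ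
  R≤ j = proj₂ (proj₂ (scaled-release j))

  open Greedy σ prio fifo run R (λ j → proj₁ (proj₂ (scaled-release j)))
    hiding (module Path; at-origin)

  release-antitone : ∀ {j k} → prio j ≤ prio k → release k ≤ release j
  release-antitone {j} {k} j≤k = ≮⇒≥ λ rj<rk → <⇒≱ (proj₂ fifo-prio j k rj<rk) j≤k

  Dominated : Fin m → ℕ → Set
  Dominated j c = ∃ λ k → ∃ λ T → Completion I opt k T × release k ≤ release j × toℚ c ≤ℚ σ ℚ.* toℚ T

  chain-bound : ∀ {j c} → Chain j c → Dominated j c
  chain-bound {j} {c} chain = k , T , proj₂ (completion k) ,
      release-antitone (argmax-all C {λ x → prio j ≤ prio x} (All.head above) (All.tail above)) , c≤σT
    where
    open Chain chain
    C : Fin m → ℕ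
    C x = proj₁ (completion x)
    -- The chain member delivered last by the feasible schedule; by time `T` the whole chain has
    -- arrived.
    k = argmax C last delayed
    T = C k
    r = release last
    s = sum (map (λ x → δ x ⊓ γ₀ dI) delayed)
    y = sum (map (λ x → δ x ⊓ γ dI) delayed)

    arrived : All (λ x → opt T x ≡ sink) (last ∷ delayed)
    arrived = All.map (λ {x} Cx≤T → Path.at-sink-since x Cx≤T (proj₁ (proj₂ (completion x))))
      (f[⊥]≤f[argmax] {f = C} last delayed ∷ f[xs]≤f[argmax] {f = C} last delayed)

    r≤T : r ≤ T
    r≤T = release-before last-moves (All.head arrived)
    -- Length of the window from the release of `last` to `T`, into which all work of the chain must
    -- fit.
    A = proj₁ (offset r≤T)
    r+A≡T : r + A ≡ T
    r+A≡T = trans (+-comm r A) (proj₂ (offset r≤T))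

    work≤A : (δ last ⊓ γ₀ dI) + s ≤ A
    work≤A = +-cancelˡ-≤ r _ _ (subst (r + _ ≤_) (sym r+A≡T)
      (workload-bound unique r≤T (≤-refl ∷ All.map release-antitone below) arrived))

    -- The full distance of `last`, of which the capped workload counts only a part, fits into the
    -- same window.
    δ≤A : δ last ≤ A
    δ≤A = +-cancelˡ-≤ r _ _ (subst₂ (λ v t → r + depth v ≤ t) (at-origin last r ≤-refl) (sym r+A≡T)
      (Path.arrival-bound last r≤T (All.head arrived)))

    c≤σT : toℚ c ≤ℚ σ ℚ.* toℚ T
    c≤σT = scale-bound {σ} {R last} {r} {c} {δ last + y} {A}
      (R≤ last) (≤-trans bound (≤-reflexive (+-assoc (R last) (δ last) y)))
      (speed-suffices {dI} {σ} {A} {suc (δ last + y)} 1≤dI threshold≤σ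
        (chain-arithmetic {γ₀ dI} {γ dI} {δ last ⊓ γ₀ dI} {s} {δ last} {y} {A}
          -- As `last` starts off the sink and `γ₀` is positive, its capped distance is at least 1.
          (γ₀≤γ dI) (⊓-glb (dist-pos last-moves) (γ₀-pos 1≤dI)) work≤A δ≤A
          (sum-map-scale (γ₀ dI) (γ dI) (λ x → ⊓-scale (δ x) (γ₀≤γ dI)) delayed)))
      r+A≡T

  completion-dominated : ∀ j → ∃ λ c → Completion I fifo j c × Dominated j c
  completion-dominated j = compare (origin j Fin.≟ sink) (completion-chain j)
    where
    compare : Dec (origin j ≡ sink) → ∃ (λ c → Completion I fifo j c × (origin j ≢ sink → Chain j c)) →
              ∃ λ c → Completion I fifo j c × Dominated j c
    compare (no o≢s)  (c , done , chain) = c , done , chain-bound (chain o≢s)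
    -- A packet originating at the sink completes at time 0 in both schedules and dominates itself.
    compare (yes o≡s) _                  = 0 , (trans (proj₁ run j) o≡s , λ _ ()) ,
      j , 0 , (trans (proj₁ feasible j) o≡s , λ _ ()) , ≤-refl , ℚ.≤-reflexive (sym (ℚ.*-zeroʳ σ))

-- The maxima are compared without being formed: each packet of the FIFO run is matched, for each
-- objective, with a packet of the feasible schedule whose cost is at least as large.
theorem4p6 : (I : Instance) → 1 ≤ Instance.dI I → Connected (Instance.graph I)
    → (σ : ℚ) → .{{_ : NonZero σ}} → speedThreshold (Instance.dI I) ≤ℚ σ
    → (prio : Fin (Instance.m I) → ℕ) → FIFOPriority I prio
    → (fifo : Positions I) → GreedyRun I σ prio fifo
    → (opt : Positions I) → Feasible I opt
    → ∀ j → ∃ λ c′ → Completion I fifo j c′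
    × (∃ λ k → ∃ λ c → Completion I opt k c
    × (toℚ c′ ÷ σ) ≤ℚ toℚ c)
    × (∃ λ k → ∃ λ c → Completion I opt k c
    × ((toℚ c′ ÷ σ) - toℚ (Instance.release I j)) ≤ℚ (toℚ c - toℚ (Instance.release I k)))
theorem4p6 I 1≤dI connected σ threshold≤σ prio fifo-prio fifo run opt feasible j =
  let open Comparison I 1≤dI connected σ threshold≤σ prio fifo-prio fifo run opt feasible
      c′ , done , k , c , opt-done , rk≤rj , c′≤σc = completion-dominated j
      c′÷σ≤c = ÷-≤ σ σ>0 c′≤σc
  in  c′ , done , (k , c , opt-done , c′÷σ≤c) ,
      -- The same `k` serves for flow times, because its release is no later than that of `j`.
      (k , c , opt-done , ℚ.+-mono-≤ c′÷σ≤c (ℚ.neg-antimono-≤ (toℚ-mono-≤ rk≤rj)))
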